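{- The scheme $$\sim(\sim\alpha\wedge_{d}(\sim\beta\wedge_{d}(\sim\gamma\wedge_{d}\sim(\alpha\vee(\beta\vee\gamma)))))\rightarrow_{d}((\alpha\vee(\beta\vee\sim\gamma))\rightarrow_{d}(\alpha\vee\beta))$$ is not provable in the axiom system $\mathrm{D}$; that is, there are formulas $\alpha,\beta,\gamma$ for which this formula is not a theorem of $\mathrm{D}$.
   Context: Formulas are built from a countably infinite set of propositional variables using the unary connective $\sim$ (negation) and the binary connectives $\vee$ (disjunction), $\rightarrow_{d}$ (discussive implication), $\wedge_{d}$ (discussive conjunction), all treated as primitive. $\sim$ binds more tightly than the binary connectives. The axiom system $\mathrm{D}$ has as its sole rule modus ponens for $\rightarrow_{d}$ (from $\alpha$ and $\alpha\rightarrow_{d}\beta$ infer $\beta$), and as axioms all instances (for arbitrary formulas $\alpha,\beta,\gamma$) of the following schemes: D1: $\alpha\rightarrow_{d}(\beta\rightarrow_{d}\alpha)$. D2: $(\alpha\rightarrow_{d}(\beta\rightarrow_{d}\gamma))\rightarrow_{d}((\alpha\rightarrow_{d}\beta)\rightarrow_{d}(\alpha\rightarrow_{d}\gamma))$. D3: $((\alpha\rightarrow_{d}\beta)\rightarrow_{d}\alpha)\rightarrow_{d}\alpha$. D4: $(\alpha\wedge_{d}\beta)\rightarrow_{d}\alpha$. D5: $(\alpha\wedge_{d}\beta)\rightarrow_{d}\beta$. D6: $\alpha\rightarrow_{d}(\beta\rightarrow_{d}(\alpha\wedge_{d}\beta))$. D7: $\alpha\rightarrow_{d}(\alpha\vee\beta)$.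 D8: $\beta\rightarrow_{d}(\alpha\vee\beta)$. D9: $(\alpha\rightarrow_{d}\gamma)\rightarrow_{d}((\beta\rightarrow_{d}\gamma)\rightarrow_{d}((\alpha\vee\beta)\rightarrow_{d}\gamma))$. D10: $\alpha\rightarrow_{d}\sim\sim\alpha$. D11: $\sim\sim\alpha\rightarrow_{d}\alpha$. D12: $\sim(\alpha\vee\sim\alpha)\rightarrow_{d}\beta$. D13: $\sim(\alpha\vee\beta)\rightarrow_{d}\sim(\beta\vee\alpha)$. D14: $\sim(\alpha\vee\beta)\rightarrow_{d}(\sim\beta\wedge_{d}\sim\alpha)$. D15: $\sim(\sim\sim\alpha\vee\beta)\rightarrow_{d}\sim(\alpha\vee\beta)$. D16: $((\sim(\alpha\vee\beta))\rightarrow_{d}\gamma)\rightarrow_{d}((\sim\alpha\rightarrow_{d}\beta)\vee\gamma)$. D17: $\sim((\alpha\vee\beta)\vee\gamma)\rightarrow_{d}\sim(\alpha\vee(\beta\vee\gamma))$. D18: $\sim((\alpha\rightarrow_{d}\beta)\vee\gamma)\rightarrow_{d}(\alpha\wedge_{d}\sim(\beta\vee\gamma))$. D19: $\sim((\alpha\wedge_{d}\beta)\vee\gamma)\rightarrow_{d}(\alpha\rightarrow_{d}\sim(\beta\vee\gamma))$. D20: $\sim(\sim(\alpha\vee\beta)\vee\gamma)\rightarrow_{d}(\sim(\sim\alpha\vee\gamma)\vee\sim(\sim\beta\vee\gamma))$. D21: $\sim(\sim(\alpha\rightarrow_{d}\beta)\vee\gamma)\rightarrow_{d}(\alpha\rightarrow_{d}\sim(\sim\beta\vee\gamma))$.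 D22: $\sim(\sim(\alpha\wedge_{d}\beta)\vee\gamma)\rightarrow_{d}(\alpha\wedge_{d}\sim(\sim\beta\vee\gamma))$. A theorem of $\mathrm{D}$ is a formula derivable from these axioms by finitely many applications of modus ponens. A scheme is said to be unprovable in $\mathrm{D}$ if at least one of its instances is not a theorem of $\mathrm{D}$. -}

module Defs where

open import Data.Nat using (ℕ)

infix 9 ∼_
infix 5 _∨_ _→d_ _∧d_
infix 2 ⊢_

data Formula : Set where
  var  : ℕ → Formula
  ∼_   : Formula → Formula
  _∨_  : Formula → Formula → Formula
  _→d_ : Formula → Formula → Formula
  _∧d_ : Formula → Formula → Formula

-- ⊢ α : α is a theorem of the axiom system D.
data ⊢_ : Formula → Set where
  MP  : ∀ {α β} → ⊢ α → ⊢ α →d β → ⊢ β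
  D1  : ∀ α β → ⊢ α →d (β →d α)
  D2  : ∀ α β γ → ⊢ (α →d (β →d γ)) →d ((α →d β) →d (α →d γ))
  D3  : ∀ α β → ⊢ ((α →d β) →d α) →d α
  D4  : ∀ α β → ⊢ (α ∧d β) →d α
  D5  : ∀ α β → ⊢ (α ∧d β) →d β
  D6  : ∀ α β → ⊢ α →d (β →d (α ∧d β))
  D7  : ∀ α β → ⊢ α →d (α ∨ β)
  D8  : ∀ α β → ⊢ β →d (α ∨ β)
  D9  : ∀ α β γ → ⊢ (α →d γ) →d ((β →d γ) →d ((α ∨ β) →d γ))
  D10 : ∀ α → ⊢ α →d ∼ ∼ α
  D11 : ∀ α → ⊢ ∼ ∼ α →d α
  D12 : ∀ α β → ⊢ ∼ (α ∨ ∼ α) →d β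
  D13 : ∀ α β → ⊢ ∼ (α ∨ β) →d ∼ (β ∨ α)
  D14 : ∀ α β → ⊢ ∼ (α ∨ β) →d (∼ β ∧d ∼ α)
  D15 : ∀ α β → ⊢ ∼ (∼ ∼ α ∨ β) →d ∼ (α ∨ β)
  D16 : ∀ α β γ → ⊢ (∼ (α ∨ β) →d γ) →d ((∼ α →d β) ∨ γ)
  D17 : ∀ α β γ → ⊢ ∼ ((α ∨ β) ∨ γ) →d ∼ (α ∨ (β ∨ γ))
  D18 : ∀ α β γ → ⊢ ∼ ((α →d β) ∨ γ) →d (α ∧d ∼ (β ∨ γ))
  D19 : ∀ α β γ → ⊢ ∼ ((α ∧d β) ∨ γ) →d (α →d ∼ (β ∨ γ))
  D20 : ∀ α β γ → ⊢ ∼ (∼ (α ∨ β) ∨ γ) →d (∼ (∼ α ∨ γ) ∨ ∼ (∼ β ∨ γ))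
  D21 : ∀ α β γ → ⊢ ∼ (∼ (α →d β) ∨ γ) →d (α →d ∼ (∼ β ∨ γ))
  D22 : ∀ α β γ → ⊢ ∼ (∼ (α ∧d β) ∨ γ) →d (α ∧d ∼ (∼ β ∨ γ))

-- Soundness in the two-world S5 model: α →d β is read as ◇α → β, α ∧d β as
-- ◇α ∧ β, and α is valid when ◇α holds. The scheme fails there when α and β are
-- false at both worlds while γ is true at exactly one of them.

{-# OPTIONS --safe #-}
module Submission where

open import Defs
open import Data.Bool.Base using (Bool; true; false; T; not) renaming (_∧_ to _and_; _∨_ to _or_)
open import Data.Bool.Properties using (T?)
open import Data.Nat.Base using (ℕ)
open import Data.Product using (∃-syntax; _×_; _,_)
open import Relation.Nullary using (¬_; Dec)
open import Relation.Nullary.Decidable using (_×-dec_; from-yes; map′)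

Proposition : Set
Proposition = Bool × Bool

-- Each world sees both worlds, so a ◇-statement has the same truth value everywhere and a single
-- `Bool` records it.
possible : Proposition → Bool
possible (x , y) = x or y

neg : Proposition → Proposition
neg (x , y) = not x , not y

disj imp conj : Proposition → Proposition → Proposition
disj (x , y) (x′ , y′) = x or x′ , y or y′
imp  p (x , y) = not (possible p) or x , not (possible p) or y
conj p (x , y) = possible p and x , possible p and y

-- With only four propositions, quantified statements about them are settled by evaluation. Nested
-- up to three deep, this decides the validity of every axiom scheme.
∀? : {P : Proposition → Set} → (∀ p → Dec (P p)) → Dec (∀ p → P p)
∀? P? = map′
  (λ { (a , b , c , d) → λ { (true , true) → a ; (true , false) → b ; (false , true) → c ; (false , false) → d } })
  (λ f → f _ , f _ , f _ , f _)
  (P? (true , true) ×-dec P? (true , false) ×-dec P? (false , true) ×-dec P? (false , false))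

Valid : Proposition → Set
Valid p = T (possible p)

valid? : ∀ p → Dec (Valid p)
valid? p = T? (possible p)

-- Once `p` is possible, `imp p q` computes to `q` itself. Material implication would not do: its
-- two premises could be true at different worlds.
imp-elim : ∀ p q → Valid p → Valid (imp p q) → Valid q
imp-elim (true  , _)     q _ v = v
imp-elim (false , true)  q _ v = v

module _ (valuation : ℕ → Proposition) where

  ⟦_⟧ : Formula → Proposition
  ⟦ var n ⟧   = valuation n
  ⟦ ∼ α ⟧     = neg ⟦ α ⟧
  ⟦ α ∨ β ⟧   = disj ⟦ α ⟧ ⟦ β ⟧
  ⟦ α →d β ⟧  = imp ⟦ α ⟧ ⟦ β ⟧
  ⟦ α ∧d β ⟧  = conj ⟦ α ⟧ ⟦ β ⟧

  -- Induction on the derivation. An axiom's value depends only on the values of its metavariables,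
  -- so a check over at most 64 triples covers all instances.
  sound : ∀ {α} → ⊢ α → Valid ⟦ α ⟧
  sound (MP {α} {β} d e) = imp-elim ⟦ α ⟧ ⟦ β ⟧ (sound d) (sound e)
  sound (D1 α β) = from-yes (∀? λ a → ∀? λ b → valid? (imp a (imp b a))) ⟦ α ⟧ ⟦ β ⟧
  sound (D2 α β γ) = from-yes (∀? λ a → ∀? λ b → ∀? λ c → valid? (imp (imp a (imp b c)) (imp (imp a b) (imp a c)))) ⟦ α ⟧ ⟦ β ⟧ ⟦ γ ⟧
  sound (D3 α β) = from-yes (∀? λ a → ∀? λ b → valid? (imp (imp (imp a b) a) a)) ⟦ α ⟧ ⟦ β ⟧
  sound (D4 α β) = from-yes (∀? λ a → ∀? λ b → valid? (imp (conj a b) a)) ⟦ α ⟧ ⟦ β ⟧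
  sound (D5 α β) = from-yes (∀? λ a → ∀? λ b → valid? (imp (conj a b) b)) ⟦ α ⟧ ⟦ β ⟧
  sound (D6 α β) = from-yes (∀? λ a → ∀? λ b → valid? (imp a (imp b (conj a b)))) ⟦ α ⟧ ⟦ β ⟧
  sound (D7 α β) = from-yes (∀? λ a → ∀? λ b → valid? (imp a (disj a b))) ⟦ α ⟧ ⟦ β ⟧
  sound (D8 α β) = from-yes (∀? λ a → ∀? λ b → valid? (imp b (disj a b))) ⟦ α ⟧ ⟦ β ⟧
  sound (D9 α β γ) = from-yes (∀? λ a → ∀? λ b → ∀? λ c → valid? (imp (imp a c) (imp (imp b c) (imp (disj a b) c)))) ⟦ α ⟧ ⟦ β ⟧ ⟦ γ ⟧
  sound (D10 α) = from-yes (∀? λ a → valid? (imp a (neg (neg a)))) ⟦ α ⟧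
  sound (D11 α) = from-yes (∀? λ a → valid? (imp (neg (neg a)) a)) ⟦ α ⟧
  sound (D12 α β) = from-yes (∀? λ a → ∀? λ b → valid? (imp (neg (disj a (neg a))) b)) ⟦ α ⟧ ⟦ β ⟧
  sound (D13 α β) = from-yes (∀? λ a → ∀? λ b → valid? (imp (neg (disj a b)) (neg (disj b a)))) ⟦ α ⟧ ⟦ β ⟧
  sound (D14 α β) = from-yes (∀? λ a → ∀? λ b → valid? (imp (neg (disj a b)) (conj (neg b) (neg a)))) ⟦ α ⟧ ⟦ β ⟧
  sound (D15 α β) = from-yes (∀? λ a → ∀? λ b → valid? (imp (neg (disj (neg (neg a)) b)) (neg (disj a b)))) ⟦ α ⟧ ⟦ β ⟧
  -- If `∼ (α ∨ β)` is possible, the premise amounts to `γ`. Otherwise `α ∨ β` holds at both worlds,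
  -- so `β` holds wherever `α` fails, and `∼ α →d β` is possible.
  sound (D16 α β γ) = from-yes (∀? λ a → ∀? λ b → ∀? λ c → valid? (imp (imp (neg (disj a b)) c) (disj (imp (neg a) b) c))) ⟦ α ⟧ ⟦ β ⟧ ⟦ γ ⟧
  sound (D17 α β γ) = from-yes (∀? λ a → ∀? λ b → ∀? λ c → valid? (imp (neg (disj (disj a b) c)) (neg (disj a (disj b c))))) ⟦ α ⟧ ⟦ β ⟧ ⟦ γ ⟧
  sound (D18 α β γ) = from-yes (∀? λ a → ∀? λ b → ∀? λ c → valid? (imp (neg (disj (imp a b) c)) (conj a (neg (disj b c))))) ⟦ α ⟧ ⟦ β ⟧ ⟦ γ ⟧
  sound (D19 α β γ) = from-yes (∀? λ a → ∀? λ b → ∀? λ c → valid? (imp (neg (disj (conj a b) c)) (imp a (neg (disj b c))))) ⟦ α ⟧ ⟦ β ⟧ ⟦ γ ⟧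
  sound (D20 α β γ) = from-yes (∀? λ a → ∀? λ b → ∀? λ c → valid? (imp (neg (disj (neg (disj a b)) c)) (disj (neg (disj (neg a) c)) (neg (disj (neg b) c))))) ⟦ α ⟧ ⟦ β ⟧ ⟦ γ ⟧
  sound (D21 α β γ) = from-yes (∀? λ a → ∀? λ b → ∀? λ c → valid? (imp (neg (disj (neg (imp a b)) c)) (imp a (neg (disj (neg b) c))))) ⟦ α ⟧ ⟦ β ⟧ ⟦ γ ⟧
  sound (D22 α β γ) = from-yes (∀? λ a → ∀? λ b → ∀? λ c → valid? (imp (neg (disj (neg (conj a b)) c)) (conj a (neg (disj (neg b) c))))) ⟦ α ⟧ ⟦ β ⟧ ⟦ γ ⟧

proposition2p15 : ∃[ α ] ∃[ β ] ∃[ γ ] ¬ (⊢ ∼ (∼ α ∧d (∼ β ∧d (∼ γ ∧d ∼ (α ∨ (β ∨ γ))))) →d ((α ∨ (β ∨ ∼ γ)) →d (α ∨ β)))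
-- The instance evaluates to `(false , false)`, so its validity is the empty type and soundness is
-- already the refutation.
proposition2p15 = var 0 , var 0 , var 1 , sound valuation
  where
  valuation : ℕ → Proposition
  -- Since `γ` holds at one world, the innermost conjunct fails there and the outer antecedent is
  -- possible. Since `∼ γ` holds at the other, so is the inner antecedent. What remains is `α ∨ β`,
  -- false at both worlds.
  valuation 0 = false , false
  valuation _ = true , false
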